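{- $\langle\forall^\infty\forall\rangle\not\le_{\sf m}\langle\forall\forall^\infty\rangle$.
   Context: Quantifiers range over $\omega$. $\exists^\infty n\,\varphi(n)$ means $\forall m\exists n\ge m\,\varphi(n)$ and $\forall^\infty n\,\varphi(n)$ means $\exists m\forall n\ge m\,\varphi(n)$. A quantifier-pattern is a finite string $\bar{\mathsf Q}=\mathsf Q_0\dots\mathsf Q_\ell$ over $\{\exists,\forall,\exists^\infty,\forall^\infty\}$. A $\bar{\mathsf Q}$-formula is $\varphi(\bar x)\equiv\mathsf Q_0n_0\dots\mathsf Q_\ell n_\ell\,\theta(n_0,\dots,n_\ell,\bar x)$ with $\theta$ bounded. The instance $\bar x$ is a tuple of natural numbers and/or total computable functions (computable elements of $\omega^\omega$). Spaces such as $\omega\times\omega^\omega$, $(\omega^\omega)^\omega$, $\omega^{\omega\times\omega}$ are identified with $\omega^\omega$ by computable pairing. Witnesses: for $\alpha\in\omega^\omega$, $\alpha\Vdash\varphi(\bar x)$ ("$\alpha$ is a witness for $\varphi(\bar x)$") is defined by: $\alpha\Vdash\theta(\bar x)$ iff $\alpha=\bar x$ and $\theta(\bar x)$, for bounded $\theta$; $\langle t,\alpha\rangle\Vdash\exists n\varphi(n,\bar x)$ iff $\alpha\Vdash\varphi(t,\bar x)$; $\alpha\Vdash\forall n\varphi(n,\bar x)$ iff $\alpha(n)\Vdash\varphi(n,\bar x)$ for all $n$; $\langle t,\alpha\rangle\Vdash\forall^\infty n\varphi(n,\bar x)$ iff $\alpha(n)\Vdash\varphi(n,\bar x)$ for all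 $n\ge t$; $\alpha\Vdash\exists^\infty n\varphi(n,\bar x)$ iff for all $n$, writing $\alpha(n)=\langle k,\beta\rangle$, $k\ge n$ and $\beta\Vdash\varphi(k,\bar x)$. $\varphi\le_{\sf m}\psi$ if there are computable functions $\eta,r_-,r_+$ (type-two computable functionals, possibly partial but defined wherever required) such that for every instance $\bar x$: $\varphi(\bar x)$ is true iff $\psi(\eta(\bar x))$ is true; $\alpha\Vdash\varphi(\bar x)$ implies $r_-(\alpha,\bar x)\Vdash\psi(\eta(\bar x))$; $\alpha\Vdash\psi(\eta(\bar x))$ implies $r_+(\alpha,\bar x)\Vdash\varphi(\bar x)$ ($\alpha\in\omega^\omega$ arbitrary). $\langle\bar{\mathsf Q}\rangle$ denotes a fixed $\bar{\mathsf Q}$-formula to which every $\bar{\mathsf Q}$-formula is $\le_{\sf m}$-reducible; concretely $\langle\bar{\mathsf Q}\rangle(x)\equiv\mathsf Q_0n_0\dots\mathsf Q_\ell n_\ell.\ x(n_0,\dots,n_\ell)=0$ (the choice does not matter up to $\equiv_{\sf m}$). -}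

module Defs where

open import Data.Fin.Base using (Fin; zero; suc)
open import Data.List.Base using (List; []; _∷_)
open import Data.Nat.Base using (ℕ; zero; suc; _+_; _*_; _≤_; _<_)
open import Data.Product.Base using (Σ-syntax; ∃-syntax; _×_)
open import Data.Sum.Base using (_⊎_)
open import Data.Vec.Base using (Vec; []; _∷_; lookup; reverse; tabulate)
open import Data.Vec.Relation.Binary.Pointwise.Inductive using (Pointwise)
open import Function.Bundles using (_⇔_)
open import Relation.Binary.PropositionalEquality using (_≡_; _≗_)
open import Relation.Nullary.Negation using (¬_)

Baire : Set
Baire = ℕ → ℕ

triangle : ℕ → ℕ
triangle zero    = 0
triangle (suc n) = suc n + triangle n

-- The Cantor bijection ω × ω → ω.
pair : ℕ → ℕ → ℕ
pair m n = triangle (m + n) + n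

-- ω × ω^ω is identified with ω^ω by prepending: ⟨t,α⟩ = cons t α.
cons : ℕ → Baire → Baire
cons t α zero    = t
cons t α (suc n) = α n

head : Baire → ℕ
head α = α 0

tail : Baire → Baire
tail α n = α (suc n)

-- (ω^ω)^ω is identified with ω^ω by Cantor pairing: row α n is "α(n)".
row : Baire → ℕ → Baire
row α n m = α (pair n m)

-- An instance (numbers ns, function x) as one element of ω^ω.  As in
-- Formula below, ns lists the most recently bound variable first.
tupleᴮ : ∀ {k} → Vec ℕ k → Baire → Baire
tupleᴮ []       x = x
tupleᴮ (n ∷ ns) x = cons n (tupleᴮ ns x)

-- Code o n: codes of n-ary partial functions with o function oracles.
data Code (o : ℕ) : ℕ → Set where
  zeroᶜ  : ∀ {n} → Code o n
  succᶜ  : Code o 1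
  projᶜ  : ∀ {n} → Fin n → Code o n
  oracle : Fin o → Code o 1
  comp   : ∀ {m n} → Code o m → Vec (Code o n) m → Code o n
  prec   : ∀ {n} → Code o n → Code o (suc (suc n)) → Code o (suc n)
  mu     : ∀ {n} → Code o (suc n) → Code o n

-- Eval Ω e xs y: the computation of e on input xs with oracles Ω halts
-- with output y.
data Eval {o : ℕ} (Ω : Vec Baire o) :
          ∀ {n} → Code o n → Vec ℕ n → ℕ → Set where
  eval-zero   : ∀ {n} {xs : Vec ℕ n} → Eval Ω zeroᶜ xs 0
  eval-succ   : ∀ {x} → Eval Ω succᶜ (x ∷ []) (suc x)
  eval-proj   : ∀ {n} {i : Fin n} {xs} → Eval Ω (projᶜ i) xs (lookup xs i)
  eval-oracle : ∀ {i x} → Eval Ω (oracle i) (x ∷ []) (lookup Ω i x)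
  eval-comp   : ∀ {m n} {f : Code o m} {gs : Vec (Code o n) m} {xs ys z} →
                Pointwise (λ g y → Eval Ω g xs y) gs ys →
                Eval Ω f ys z →
                Eval Ω (comp f gs) xs z
  eval-prec-zero : ∀ {n} {g : Code o n} {h xs y} →
                Eval Ω g xs y →
                Eval Ω (prec g h) (zero ∷ xs) y
  eval-prec-suc  : ∀ {n} {g : Code o n} {h xs k r y} →
                Eval Ω (prec g h) (k ∷ xs) r →
                Eval Ω h (k ∷ r ∷ xs) y →
                Eval Ω (prec g h) (suc k ∷ xs) y
  eval-mu     : ∀ {n} {f : Code o (suc n)} {xs k} →
                (∀ i → i < k → ∃[ v ] Eval Ω f (i ∷ xs) (suc v)) →
                Eval Ω f (k ∷ xs) 0 →
                Eval Ω (mu f) xs k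

-- The partial functional with code e is defined at the arguments Ω and its
-- value there is β.
Computes : ∀ {o} → Code o 1 → Vec Baire o → Baire → Set
Computes e Ω β = ∀ n → Eval Ω e (n ∷ []) (β n)

Computable : Baire → Set
Computable x = ∃[ e ] Computes {0} e [] x

-- Terms and bounded formulas have k number variables (de Bruijn: variable 0
-- is the most recently bound) and one function parameter, the instance x.
data Term (k : ℕ) : Set where
  var     : Fin k → Term k
  zeroᵗ   : Term k
  sucᵗ    : Term k → Term k
  _+ᵗ_    : Term k → Term k → Term k
  _*ᵗ_    : Term k → Term k → Term k
  ⟪_,_⟫   : Term k → Term k → Term k
  param   : Term k → Term k

evalᵗ : ∀ {k} → Term k → Vec ℕ k → Baire → ℕ
evalᵗ (var i)     ns x = lookup ns i
evalᵗ zeroᵗ       ns x = 0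
evalᵗ (sucᵗ t)    ns x = suc (evalᵗ t ns x)
evalᵗ (s +ᵗ t)    ns x = evalᵗ s ns x + evalᵗ t ns x
evalᵗ (s *ᵗ t)    ns x = evalᵗ s ns x * evalᵗ t ns x
evalᵗ ⟪ s , t ⟫   ns x = pair (evalᵗ s ns x) (evalᵗ t ns x)
evalᵗ (param t)   ns x = x (evalᵗ t ns x)

data Bounded (k : ℕ) : Set where
  _≐_       : Term k → Term k → Bounded k
  ¬ᵇ_       : Bounded k → Bounded k
  _∧ᵇ_ _∨ᵇ_ : Bounded k → Bounded k → Bounded k
  ∀<_∙_     : Term k → Bounded (suc k) → Bounded k
  ∃<_∙_     : Term k → Bounded (suc k) → Bounded k

Trueᵇ : ∀ {k} → Bounded k → Vec ℕ k → Baire → Set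
Trueᵇ (s ≐ t)    ns x = evalᵗ s ns x ≡ evalᵗ t ns x
Trueᵇ (¬ᵇ θ)     ns x = ¬ Trueᵇ θ ns x
Trueᵇ (θ ∧ᵇ χ)   ns x = Trueᵇ θ ns x × Trueᵇ χ ns x
Trueᵇ (θ ∨ᵇ χ)   ns x = Trueᵇ θ ns x ⊎ Trueᵇ χ ns x
Trueᵇ (∀< t ∙ θ) ns x = ∀ n → n < evalᵗ t ns x → Trueᵇ θ (n ∷ ns) x
Trueᵇ (∃< t ∙ θ) ns x = ∃[ n ] (n < evalᵗ t ns x × Trueᵇ θ (n ∷ ns) x)

data Quantifier : Set where
  ∃ᵠ ∀ᵠ ∃^∞ ∀^∞ : Quantifier

Pattern : Set
Pattern = List Quantifier

-- Formula k Q̄: Q̄-formulas whose instances are a k-tuple of numbers together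
-- with one element of ω^ω.
data Formula (k : ℕ) : Pattern → Set where
  matrix : Bounded k → Formula k []
  quant  : ∀ {Qs} (Q : Quantifier) → Formula (suc k) Qs → Formula k (Q ∷ Qs)

True : ∀ {k Qs} → Formula k Qs → Vec ℕ k → Baire → Set
True (matrix θ)    ns x = Trueᵇ θ ns x
True (quant ∃ᵠ φ)  ns x = ∃[ n ] True φ (n ∷ ns) x
True (quant ∀ᵠ φ)  ns x = ∀ n → True φ (n ∷ ns) x
True (quant ∃^∞ φ) ns x = ∀ m → ∃[ n ] (m ≤ n × True φ (n ∷ ns) x)
True (quant ∀^∞ φ) ns x = ∃[ m ] (∀ n → m ≤ n → True φ (n ∷ ns) x)

-- Witness φ ns x α: α ⊩ φ(ns, x).  A code ⟨t,β⟩ is destructured with head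
-- and tail.
Witness : ∀ {k Qs} → Formula k Qs → Vec ℕ k → Baire → Baire → Set
Witness (matrix θ)    ns x α = α ≗ tupleᴮ ns x × Trueᵇ θ ns x
Witness (quant ∃ᵠ φ)  ns x α = Witness φ (head α ∷ ns) x (tail α)
Witness (quant ∀ᵠ φ)  ns x α = ∀ n → Witness φ (n ∷ ns) x (row α n)
Witness (quant ∃^∞ φ) ns x α =
  ∀ n → n ≤ head (row α n) ×
        Witness φ (head (row α n) ∷ ns) x (tail (row α n))
Witness (quant ∀^∞ φ) ns x α =
  ∀ n → head α ≤ n → Witness φ (n ∷ ns) x (row (tail α) n)

infix 4 _⊩_[_]
_⊩_[_] : ∀ {Qs} → Baire → Formula 0 Qs → Baire → Set
α ⊩ φ [ x ] = Witness φ [] x α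

-- Instances are computable; witnesses α range over all of ω^ω.  The
-- computability of η(x) need not be demanded: it follows from that of x.
record Reduces {Ps Qs} (φ : Formula 0 Ps) (ψ : Formula 0 Qs)
               (η : Code 1 1) (r₋ r₊ : Code 2 1) (x : Baire) : Set where
  field
    ηx       : Baire
    η-def    : Computes η (x ∷ []) ηx
    truth    : True φ [] x ⇔ True ψ [] ηx
    forward  : ∀ α → α ⊩ φ [ x ] →
               ∃[ β ] (Computes r₋ (α ∷ x ∷ []) β × β ⊩ ψ [ ηx ])
    backward : ∀ α → α ⊩ ψ [ ηx ] →
               ∃[ β ] (Computes r₊ (α ∷ x ∷ []) β × β ⊩ φ [ x ])

infix 4 _≤ₘ_
_≤ₘ_ : ∀ {Ps Qs} → Formula 0 Ps → Formula 0 Qs → Set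
φ ≤ₘ ψ = Σ[ η ∈ Code 1 1 ] Σ[ r₋ ∈ Code 2 1 ] Σ[ r₊ ∈ Code 2 1 ]
         (∀ x → Computable x → Reduces φ ψ η r₋ r₊ x)

tupleᵗ : ∀ {k n} → Vec (Term k) n → Term k
tupleᵗ []           = zeroᵗ
tupleᵗ (t ∷ [])     = t
tupleᵗ (t ∷ u ∷ ts) = ⟪ t , tupleᵗ (u ∷ ts) ⟫

-- ⟨Q̄⟩(x) ≡ Q₀n₀…Q_ℓn_ℓ. x(n₀,…,n_ℓ) = 0, with ω^(ℓ+1) coded by iterated
-- pairing; the reversal puts the outermost variable n₀ first.
completeFrom : ∀ k Qs → Formula k Qs
completeFrom k []       = matrix (param (tupleᵗ (reverse (tabulate var))) ≐ zeroᵗ)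
completeFrom k (Q ∷ Qs) = quant Q (completeFrom (suc k) Qs)

⟨_⟩ : (Qs : Pattern) → Formula 0 Qs
⟨ Qs ⟩ = completeFrom 0 Qs

{-# OPTIONS --safe #-}

-- A reduction only ever sees finitely much of its oracles.  Let r₊ turn a
-- witness for the image y of the zero instance into a bound s on the nonzero
-- rows.  The instances x_K with a single 1, in row s and column K, converge to
-- zero and all satisfy the formula with bound s + 1, so r₋ provides moduli for
-- their images y_K that converge as K grows; on each row the relevant part of
-- y_K is then a fixed finite segment, on which y_K eventually agrees with y.
-- Hence the moduli of y are eventually valid for y_K on any given finite set of
-- rows, and r₊ also answers s for x_K, which is wrong since row s of x_K is not
-- zero.

module Submission where

open import Data.Fin.Base using (zero; suc)
open import Data.List.Base using ([]; _∷_)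
open import Data.Nat.Base using (ℕ; zero; suc; _+_; _≤_; _<_; _⊔_; s≤s)
open import Data.Nat.Properties
open import Data.Product.Base using (_×_; _,_; proj₁; proj₂; ∃-syntax)
open import Data.Sum.Base using (inj₁; inj₂)
open import Data.Vec.Base using (Vec; []; _∷_; lookup)
open import Data.Vec.Relation.Binary.Pointwise.Inductive using (Pointwise; []; _∷_)
open import Function.Base using (case_of_)
open import Relation.Binary.Definitions using (tri<; tri≈; tri>)
open import Relation.Binary.PropositionalEquality
open import Relation.Nullary.Decidable using (Dec; yes; no; _→-dec_)
open import Relation.Nullary.Negation using (¬_; contradiction)
open import Defs

-- Cantor pairing

-- Counts along the antidiagonals, so that the two successor clauses mirror `pair-zeroʳ` and
-- `pair-sucʳ`.
unpair : ℕ → ℕ × ℕ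
unpair zero    = 0 , 0
unpair (suc p) with unpair p
... | zero  , n = suc n , 0
... | suc m , n = m , suc n

pair-zeroʳ : ∀ m → pair (suc m) 0 ≡ suc (pair 0 m)
pair-zeroʳ m rewrite +-identityʳ m | +-identityʳ (m + triangle m) =
  cong suc (+-comm m (triangle m))

pair-sucʳ : ∀ m n → pair m (suc n) ≡ suc (pair (suc m) n)
pair-sucʳ m n rewrite +-suc m n = +-suc (triangle (suc (m + n))) n

unpair-pair : ∀ m n → unpair (pair m n) ≡ (m , n)
unpair-pair m n = go (m + n) m n refl
  where
  -- Lexicographic recursion: `n` drops along an antidiagonal; at `n = 0` the end of the previous
  -- one is next, and `s` drops.
  go : ∀ s m n → m + n ≡ s → unpair (pair m n) ≡ (m , n)
  go s m (suc n) eq = trans (cong unpair (pair-sucʳ m n))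
    (unpair-suc (pair (suc m) n) (go s (suc m) n (trans (sym (+-suc m n)) eq)))
    where
    unpair-suc : ∀ p → unpair p ≡ (suc m , n) → unpair (suc p) ≡ (m , suc n)
    unpair-suc p eq rewrite eq = refl
  go s zero zero eq = refl
  go (suc s) (suc m) zero eq = trans (cong unpair (pair-zeroʳ m))
    (unpair-suc (pair 0 m) (go s 0 m (trans (sym (+-identityʳ m)) (suc-injective eq))))
    where
    unpair-suc : ∀ p → unpair p ≡ (0 , m) → unpair (suc p) ≡ (suc m , 0)
    unpair-suc p eq rewrite eq = refl

pair-injectiveˡ : ∀ m n m′ n′ → pair m n ≡ pair m′ n′ → m ≡ m′
pair-injectiveˡ m n m′ n′ eq =
  cong proj₁ (trans (sym (unpair-pair m n)) (trans (cong unpair eq) (unpair-pair m′ n′)))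

spread : (ℕ → Baire) → Baire
spread f p = f (proj₁ (unpair p)) (proj₂ (unpair p))

row-spread : ∀ f n → row (spread f) n ≗ f n
row-spread f n m = cong (λ (i , j) → f i j) (unpair-pair n m)

-- Eventual properties and pointwise convergence

Eventually : (ℕ → Set) → Set
Eventually P = ∃[ N ] (∀ n → N ≤ n → P n)

always : ∀ {P} → (∀ n → P n) → Eventually P
always p = 0 , λ n _ → p n

mapᵉ : ∀ {P Q} → (∀ {n} → P n → Q n) → Eventually P → Eventually Q
mapᵉ f (N , p) = N , λ n N≤n → f (p n N≤n)

zipᵉ : ∀ {P Q R} → (∀ {n} → P n → Q n → R n) →
       Eventually P → Eventually Q → Eventually R
zipᵉ f (M , p) (N , q) =
  M ⊔ N , λ n M⊔N≤n → f (p n (m⊔n≤o⇒m≤o M N M⊔N≤n)) (q n (m⊔n≤o⇒n≤o M N M⊔N≤n))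

eventually-∀< : ∀ {P : ℕ → ℕ → Set} k → (∀ i → i < k → Eventually (P i)) →
                Eventually (λ n → ∀ i → i < k → P i n)
eventually-∀< zero    h = always λ _ _ ()
eventually-∀< {P} (suc k) h =
  zipᵉ extend (eventually-∀< k (λ i i<k → h i (m<n⇒m<1+n i<k))) (h k (n<1+n k))
  where
  extend : ∀ {n} → (∀ i → i < k → P i n) → P k n → ∀ i → i < suc k → P i n
  extend p q i (s≤s i≤k) with m≤n⇒m<n∨m≡n i≤k
  ... | inj₁ i<k  = p i i<k
  ... | inj₂ refl = q

infix 4 _⟶_
record _⟶_ (A : ℕ → Baire) (α : Baire) : Set where
  field
    at : ∀ i → Eventually λ n → A n i ≡ α i

open _⟶_

cons-⟶ : ∀ {h : ℕ → ℕ} {k A α} → Eventually (λ n → h n ≡ k) → A ⟶ α →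
         (λ n → cons (h n) (A n)) ⟶ cons k α
cons-⟶ h⟶k A⟶α .at zero    = h⟶k
cons-⟶ h⟶k A⟶α .at (suc i) = A⟶α .at i

spread-⟶ : {F : ℕ → ℕ → Baire} {f : ℕ → Baire} →
           (∀ m → (λ n → F n m) ⟶ f m) → (λ n → spread (F n)) ⟶ spread f
spread-⟶ F⟶f .at p = F⟶f (proj₁ (unpair p)) .at (proj₂ (unpair p))

-- Determinism and continuity of oracle computations

module _ {o} {Ω : Vec Baire o} where

  eval-deterministic  : ∀ {n} {e : Code o n} {xs y z} →
                        Eval Ω e xs y → Eval Ω e xs z → y ≡ z
  evals-deterministic : ∀ {m n} {es : Vec (Code o n) m} {xs ys zs} →
                        Pointwise (λ e y → Eval Ω e xs y) es ys →
                        Pointwise (λ e y → Eval Ω e xs y) es zs → ys ≡ zs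

  eval-deterministic eval-zero eval-zero = refl
  eval-deterministic eval-succ eval-succ = refl
  eval-deterministic eval-proj eval-proj = refl
  eval-deterministic eval-oracle eval-oracle = refl
  eval-deterministic (eval-comp gs f) (eval-comp gs′ f′)
    with refl ← evals-deterministic gs gs′ = eval-deterministic f f′
  eval-deterministic (eval-prec-zero g) (eval-prec-zero g′) = eval-deterministic g g′
  eval-deterministic (eval-prec-suc r h) (eval-prec-suc r′ h′)
    with refl ← eval-deterministic r r′ = eval-deterministic h h′
  eval-deterministic (eval-mu {k = k} below at) (eval-mu {k = k′} below′ at′)
    with <-cmp k k′
  ... | tri≈ _ k≡k′ _ = k≡k′
  ... | tri< k<k′ _ _ with _ , e ← below′ k k<k′ with () ← eval-deterministic at e
  ... | tri> _ _ k′<k with _ , e ← below k′ k′<k with () ← eval-deterministic e at′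

  evals-deterministic [] [] = refl
  evals-deterministic (e ∷ es) (e′ ∷ es′) =
    cong₂ _∷_ (eval-deterministic e e′) (evals-deterministic es es′)

module _ {o} {Ωs : ℕ → Vec Baire o} {Ω : Vec Baire o}
         (Ωs⟶Ω : ∀ j → (λ n → lookup (Ωs n) j) ⟶ lookup Ω j) where

  -- A halting computation queries its oracles finitely often, and those values stabilise. A search
  -- ending at `k` adds only `k + 1` subcomputations.
  eval-continuous  : ∀ {n} {e : Code o n} {xs y} → Eval Ω e xs y →
                     Eventually λ k → Eval (Ωs k) e xs y
  evals-continuous : ∀ {m n} {es : Vec (Code o n) m} {xs ys} →
                     Pointwise (λ e y → Eval Ω e xs y) es ys →
                     Eventually λ k → Pointwise (λ e y → Eval (Ωs k) e xs y) es ys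

  eval-continuous eval-zero = always λ _ → eval-zero
  eval-continuous eval-succ = always λ _ → eval-succ
  eval-continuous eval-proj = always λ _ → eval-proj
  eval-continuous (eval-oracle {i} {x}) =
    mapᵉ (λ eq → subst (Eval _ (oracle i) (x ∷ [])) eq eval-oracle) (Ωs⟶Ω i .at x)
  eval-continuous (eval-comp gs f) =
    zipᵉ eval-comp (evals-continuous gs) (eval-continuous f)
  eval-continuous (eval-prec-zero g) = mapᵉ eval-prec-zero (eval-continuous g)
  eval-continuous (eval-prec-suc r h) =
    zipᵉ eval-prec-suc (eval-continuous r) (eval-continuous h)
  eval-continuous (eval-mu {f = f} {xs} {k} below at) =
    zipᵉ eval-mu (eventually-∀< k step) (eval-continuous at)
    where
    step : ∀ i → i < k → Eventually λ n → ∃[ v ] Eval (Ωs n) f (i ∷ xs) (suc v)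
    step i i<k with v , e ← below i i<k = mapᵉ (v ,_) (eval-continuous e)

  evals-continuous [] = always λ _ → []
  evals-continuous (e ∷ es) = zipᵉ _∷_ (eval-continuous e) (evals-continuous es)

  -- By continuity `β i` is eventually a value computed from `Ωs n`; by determinism it is `B n i`.
  -- Computability of `η`, `r₋` and `r₊` enters the argument only through this.
  computes-continuous : ∀ {e B β} → Computes e Ω β →
                        (∀ n → Computes e (Ωs n) (B n)) → B ⟶ β
  computes-continuous c cs .at i with N , p ← eval-continuous (c i) =
    N , λ n N≤n → eval-deterministic (cs n i) (p n N≤n)

-- Instances with at most one nonzero value

𝟎 : Baire
𝟎 _ = 0

𝟎-computable : Computable 𝟎
𝟎-computable = zeroᶜ , λ _ → eval-zero

δ : ℕ → Baire
δ zero    zero    = 1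
δ zero    (suc n) = 0
δ (suc q) zero    = 0
δ (suc q) (suc n) = δ q n

δ-computable : ∀ q → Computable (δ q)
δ-computable zero = e , c
  where
  e = prec (comp succᶜ (zeroᶜ ∷ [])) zeroᶜ
  c : Computes e [] (δ 0)
  c zero    = eval-prec-zero (eval-comp (eval-zero ∷ []) eval-succ)
  c (suc n) = eval-prec-suc (c n) eval-zero
δ-computable (suc q) with e , c ← δ-computable q = e′ , c′
  where
  -- Recursion as a case split: the step discards the previous value and runs `e` on the
  -- predecessor.
  e′ = prec zeroᶜ (comp e (projᶜ zero ∷ []))
  c′ : Computes e′ [] (δ (suc q))
  c′ zero    = eval-prec-zero eval-zero
  c′ (suc n) = eval-prec-suc (c′ n) (eval-comp (eval-proj ∷ []) (c n))

δ-diagonal : ∀ q → δ q q ≡ 1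
δ-diagonal zero    = refl
δ-diagonal (suc q) = δ-diagonal q

δ-off-diagonal : ∀ q n → n ≢ q → δ q n ≡ 0
δ-off-diagonal zero    zero    n≢q = contradiction refl n≢q
δ-off-diagonal zero    (suc n) n≢q = refl
δ-off-diagonal (suc q) zero    n≢q = refl
δ-off-diagonal (suc q) (suc n) n≢q = δ-off-diagonal q n λ n≡q → n≢q (cong suc n≡q)

δ⟶𝟎 : ∀ s → (λ K → δ (pair s K)) ⟶ 𝟎
-- As `K ≤ pair s K`, the position of the one moves past `i`.
δ⟶𝟎 s .at i = suc i , λ K i<K →
  δ-off-diagonal (pair s K) i (<⇒≢ (<-≤-trans i<K (m≤n+m K (triangle (s + K)))))

-- Witnesses with prescribed thresholds

-- The forced witness `tupleᴮ (k ∷ n ∷ []) x` of the matrix, innermost variable first. Both formulas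
-- have the same matrix, so both use `payload`.
matrixWitness : Baire → ℕ → ℕ → Baire
matrixWitness x n k = cons k (cons n x)

payload : Baire → ℕ → Baire
payload x n = spread (matrixWitness x n)

payload-⟶ : ∀ {X x} → X ⟶ x → ∀ n → (λ K → payload (X K) n) ⟶ payload x n
payload-⟶ X⟶x n = spread-⟶ λ k →
  cons-⟶ {h = λ _ → k} (always λ _ → refl) (cons-⟶ (always λ _ → refl) X⟶x)

-- A canonical choice, continuous in `x`: converging instances get converging witnesses.
∀^∞∀-witness : ℕ → Baire → Baire
∀^∞∀-witness t x = cons t (spread (payload x))

∀^∞∀-witness-⊩ : ∀ {t x} → (∀ n → t ≤ n → ∀ k → x (pair n k) ≡ 0) →
                ∀^∞∀-witness t x ⊩ ⟨ ∀^∞ ∷ ∀ᵠ ∷ [] ⟩ [ x ]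
∀^∞∀-witness-⊩ {t} {x} zeros n t≤n k =
  (λ i → trans (row-spread (payload x) n (pair k i)) (row-spread (matrixWitness x n) k i)) ,
  zeros n t≤n k

∀^∞∀-witness-⟶ : ∀ {X x} t → X ⟶ x → (λ K → ∀^∞∀-witness t (X K)) ⟶ ∀^∞∀-witness t x
∀^∞∀-witness-⟶ t X⟶x = cons-⟶ (always λ _ → refl) (spread-⟶ (payload-⟶ X⟶x))

-- The real information in a witness for `⟨ ∀ᵠ ∷ ∀^∞ ∷ [] ⟩`: a bound on the nonzero columns of each
-- row.
Modulus : Baire → Baire → Set
Modulus y f = ∀ n k → f n ≤ k → y (pair n k) ≡ 0

modulus : Baire → Baire
modulus β n = head (row β n)

modulus-⟶ : ∀ {B β} → B ⟶ β → (λ K → modulus (B K)) ⟶ modulus β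
modulus-⟶ B⟶β .at n = B⟶β .at (pair n 0)

⊩⇒Modulus : ∀ {y} β → β ⊩ ⟨ ∀ᵠ ∷ ∀^∞ ∷ [] ⟩ [ y ] → Modulus y (modulus β)
⊩⇒Modulus β β⊩ n k f≤k = proj₂ (β⊩ n k f≤k)

∀∀^∞-witness : Baire → Baire → Baire
∀∀^∞-witness f y = spread λ n → cons (f n) (payload y n)

∀∀^∞-witness-⊩ : ∀ {f y} → Modulus y f → ∀∀^∞-witness f y ⊩ ⟨ ∀ᵠ ∷ ∀^∞ ∷ [] ⟩ [ y ]
∀∀^∞-witness-⊩ {f} {y} mod n k head≤k =
  -- Position 0 of the row holds the threshold, hence the shift by one.
  (λ i → trans (row-spread g n (suc (pair k i))) (row-spread (matrixWitness y n) k i)) ,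
  mod n k (subst (_≤ k) (row-spread g n 0) head≤k)
  where
  g : ℕ → Baire
  g n = cons (f n) (payload y n)

∀∀^∞-witness-⟶ : ∀ {F f Y y} → F ⟶ f → Y ⟶ y →
                (λ K → ∀∀^∞-witness (F K) (Y K)) ⟶ ∀∀^∞-witness f y
∀∀^∞-witness-⟶ F⟶f Y⟶y = spread-⟶ λ n → cons-⟶ (F⟶f .at n) (payload-⟶ Y⟶y n)

-- A given modulus g of y is replaced by f on the rows where f is decidably
-- correct: below g only finitely many values need checking.
module _ (y f g : Baire) where

  Replaceable : ℕ → Set
  Replaceable n = ∀ {k} → k < g n → f n ≤ k → y (pair n k) ≡ 0

  replaceable? : ∀ n → Dec (Replaceable n)
  replaceable? n = allUpTo? (λ k → f n ≤? k →-dec y (pair n k) ≟ 0) (g n)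

  replace : Baire
  replace n with replaceable? n
  ... | yes _ = f n
  ... | no  _ = g n

  replace-Modulus : Modulus y g → Modulus y replace
  replace-Modulus mod n k l≤k with replaceable? n
  ... | no  _ = mod n k l≤k
  ... | yes r with k <? g n
  ...   | yes k<g = r k<g l≤k
  ...   | no  k≮g = mod n k (≮⇒≥ k≮g)

  replace-replaceable : ∀ n → Replaceable n → replace n ≡ f n
  replace-replaceable n r with replaceable? n
  ... | yes _ = refl
  ... | no ¬r = contradiction (λ {k} → r {k}) ¬r

-- On row `n` the test looks only at columns below `G K n`, which is eventually `g n`. There `Y K`
-- eventually equals `y`, for which `f` is correct, so the test succeeds.
replace-⟶ : ∀ {Y y f G g} → Y ⟶ y → G ⟶ g → Modulus y f →
          (λ K → replace (Y K) f (G K)) ⟶ f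
replace-⟶ {Y} {y} {f} {G} {g} Y⟶y G⟶g mod .at n =
  zipᵉ (λ {K} → agree {K}) (G⟶g .at n) (eventually-∀< (g n) λ k _ → Y⟶y .at (pair n k))
  where
  agree : ∀ {K} → G K n ≡ g n → (∀ k → k < g n → Y K (pair n k) ≡ y (pair n k)) →
          replace (Y K) f (G K) n ≡ f n
  agree {K} G≡g Y≡y = replace-replaceable (Y K) f (G K) n λ {k} k<G f≤k →
    trans (Y≡y k (subst (k <_) G≡g k<G)) (mod n k f≤k)

theorem4p13 : ¬ (⟨ ∀^∞ ∷ ∀ᵠ ∷ [] ⟩ ≤ₘ ⟨ ∀ᵠ ∷ ∀^∞ ∷ [] ⟩)
theorem4p13 (η , r₋ , r₊ , reduces) = case trans (sym (δ-diagonal (pair s K))) δ≡0 of λ ()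
  where
  module R₀ = Reduces (reduces 𝟎 𝟎-computable)

  forward₀ : ∀ t → _
  forward₀ t = R₀.forward (∀^∞∀-witness t 𝟎) (∀^∞∀-witness-⊩ λ _ _ _ → refl)

  y f₀ : Baire
  y  = R₀.ηx
  -- Threshold 0 is an arbitrary choice, as all rows of `𝟎` vanish. Since `s` will depend on `f₀`,
  -- the threshold `suc s` is not yet available.
  f₀ = modulus (proj₁ (forward₀ 0))

  f₀-Modulus : Modulus y f₀
  f₀-Modulus = ⊩⇒Modulus (proj₁ (forward₀ 0)) (proj₂ (proj₂ (forward₀ 0)))

  back₀ = R₀.backward (∀∀^∞-witness f₀ y) (∀∀^∞-witness-⊩ f₀-Modulus)

  s : ℕ
  s = head (proj₁ back₀)

  x : ℕ → Baire
  x K = δ (pair s K)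

  module R K = Reduces (reduces (x K) (δ-computable (pair s K)))

  forwardₖ : ∀ K → _
  forwardₖ K = R.forward K (∀^∞∀-witness (suc s) (x K)) (∀^∞∀-witness-⊩ λ n s<n k →
    δ-off-diagonal (pair s K) (pair n k) λ eq →
      <⇒≢ s<n (sym (pair-injectiveˡ n k s K eq)))

  β : ℕ → Baire
  β K = proj₁ (forwardₖ K)

  y⟶ : (λ K → R.ηx K) ⟶ y
  y⟶ = computes-continuous (λ { zero → δ⟶𝟎 s }) R₀.η-def (λ K → R.η-def K)

  β⟶ : β ⟶ proj₁ (forward₀ (suc s))
  β⟶ = computes-continuous
         (λ { zero → ∀^∞∀-witness-⟶ (suc s) (δ⟶𝟎 s) ; (suc zero) → δ⟶𝟎 s })
         (proj₁ (proj₂ (forward₀ (suc s)))) (λ K → proj₁ (proj₂ (forwardₖ K)))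

  -- The moduli of `β K` converge, but to the one obtained from threshold `suc s`, which may differ
  -- from `f₀`. Replacement moves the limit to `f₀`, the modulus that produced `s`.
  f : ℕ → Baire
  f K = replace (R.ηx K) f₀ (modulus (β K))

  f⟶ : f ⟶ f₀
  f⟶ = replace-⟶ y⟶ (modulus-⟶ β⟶) f₀-Modulus

  backₖ : ∀ K → _
  backₖ K = R.backward K (∀∀^∞-witness (f K) (R.ηx K))
    (∀∀^∞-witness-⊩ (replace-Modulus (R.ηx K) f₀ (modulus (β K))
      (⊩⇒Modulus (β K) (proj₂ (proj₂ (forwardₖ K))))))

  bounds⟶ : (λ K → proj₁ (backₖ K)) ⟶ proj₁ back₀
  bounds⟶ = computes-continuous
              (λ { zero → ∀∀^∞-witness-⟶ f⟶ y⟶ ; (suc zero) → δ⟶𝟎 s })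
              (proj₁ (proj₂ back₀)) (λ K → proj₁ (proj₂ (backₖ K)))

  K : ℕ
  K = proj₁ (bounds⟶ .at 0)

  δ≡0 : δ (pair s K) (pair s K) ≡ 0
  -- At this `K` the threshold returned for `x K` is again `s`, so the witness vouches for a zero in
  -- row `s`, column `K`.
  δ≡0 = proj₂ (proj₂ (proj₂ (backₖ K)) s (≤-reflexive (proj₂ (bounds⟶ .at 0) K ≤-refl)) K)
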